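{- For all integers $n\ge 1$ and $0\le m\le t(n)$, $$F(n,m)=\min_{1\le q\le n}\left\{s(q)+F\bigl(n-q,\max\{0,m-t(q)\}\bigr)\right\},$$ where $q$ ranges over integers.
   Context: $\mathbb N$ denotes the positive integers. For a positive integer $q$, $t(q)=\lfloor q^2/4\rfloor$ and $s(q)=\lfloor (q-1)^2/4\rfloor$. For integers $n\ge1$ and $m\ge 0$, $$F(n,m)=\min\left\{\sum_{i=1}^k s(q_i):\ k,q_1,\ldots,q_k\in\mathbb N,\ \sum_{i=1}^k q_i=n,\ \sum_{i=1}^k t(q_i)\ge m\right\},$$ with $F(n,m)=+\infty$ when no such (admissible) partition exists. For $n=0$ the empty partition is allowed, so that $F(0,0)=0$ and $F(0,m)=+\infty$ for $m\ge1$. -}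

module Defs where

open import Data.List.Base
  using (List; []; _∷_; [_]; length; map; upTo; filter; concatMap; cartesianProductWith)
open import Data.List.Membership.Propositional using (_∈_; lose)
open import Data.List.Membership.Propositional.Properties
  using (∈-map⁺; ∈-map⁻; ∈-filter⁺; ∈-filter⁻; ∈-concatMap⁺; ∈-upTo⁺; ∈-cartesianProductWith⁺)
open import Data.List.Relation.Unary.All as All using (All; []; _∷_)
open import Data.List.Relation.Unary.Any using (here)
open import Data.Nat.Base using (ℕ; zero; suc; _+_; _∸_; _^_; _≤_; z≤n; s≤s)
open import Data.Nat.DivMod using (_/_)
open import Data.Nat.ListAction using (sum)
open import Data.Nat.Properties
open import Data.Product.Base using (∃-syntax; _×_; _,_)
open import Data.Sum.Base using (inj₁; inj₂)
open import Relation.Binary.Bundles using (TotalOrder)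
open import Relation.Binary.PropositionalEquality.Core using (_≡_; refl)
import Relation.Binary.Construct.Add.Supremum.NonStrict as AddSupremum
import Data.List.Extrema as Extrema
open import Relation.Nullary.Construct.Add.Supremum using (_⁺; ⊤⁺) renaming ([_] to fin)
open import Relation.Nullary.Decidable.Core using (Dec; _×-dec_)
open import Relation.Nullary.Negation.Core using (¬_)

open AddSupremum _≤_ using (_≤⁺_; ≤⁺-isTotalOrder-≡; [≤]-injective)

-- ℕ ∪ {+∞}, with fin : ℕ → ℕ∞ and ⊤⁺ = +∞.
ℕ∞ : Set
ℕ∞ = ℕ ⁺

ℕ∞-totalOrder : TotalOrder _ _ _
ℕ∞-totalOrder = record { isTotalOrder = ≤⁺-isTotalOrder-≡ ≤-isTotalOrder }

open Extrema ℕ∞-totalOrder using (min; min≤xs; argmin-sel)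

infixr 6 _+∞_

_+∞_ : ℕ → ℕ∞ → ℕ∞
a +∞ fin b = fin (a + b)
a +∞ ⊤⁺    = ⊤⁺

-- The minimum over the empty list is +∞.
minimum : List ℕ∞ → ℕ∞
minimum = min ⊤⁺

-- The integers 1, 2, …, n.
[1⋯_] : ℕ → List ℕ
[1⋯ n ] = map suc (upTo n)

t : ℕ → ℕ
t q = (q ^ 2) / 4

-- Only used for q ≥ 1, where ∸ agrees with subtraction.
s : ℕ → ℕ
s q = ((q ∸ 1) ^ 2) / 4

-- k = length qs is arbitrary; qs = [] can only be admissible when n = 0.
Admissible : ℕ → ℕ → List ℕ → Set
Admissible n m qs = All (1 ≤_) qs × sum qs ≡ n × m ≤ sum (map t qs)

admissible? : ∀ n m qs → Dec (Admissible n m qs)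
admissible? n m qs = All.all? (1 ≤?_) qs ×-dec (sum qs ≟ n) ×-dec (m ≤? sum (map t qs))

cost : List ℕ → ℕ
cost qs = sum (map s qs)

tuples : ∀ {A : Set} → ℕ → List A → List (List A)
tuples zero    xs = [ [] ]
tuples (suc k) xs = cartesianProductWith _∷_ xs (tuples k xs)

-- All lists of length at most n with entries in {1,…,n}.  A list of positive
-- integers with sum n is one of these, so nothing is lost by searching only here.
candidates : ℕ → List (List ℕ)
candidates n = concatMap (λ k → tuples k [1⋯ n ]) (upTo (suc n))

F : ℕ → ℕ → ℕ∞
F n m = minimum (map (λ qs → fin (cost qs)) (filter (admissible? n m) (candidates n)))

-- The rest shows that F n m is the minimum of the cost over all admissible
-- lists, and +∞ exactly when there are none.

IsMinimum : (ℕ → Set) → ℕ∞ → Set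
IsMinimum P (fin v) = P v × (∀ w → P w → v ≤ w)
IsMinimum P ⊤⁺      = ∀ w → ¬ P w

∈-[1⋯]⁺ : ∀ {n q} → 1 ≤ q → q ≤ n → q ∈ [1⋯ n ]
∈-[1⋯]⁺ {q = suc q} _ q≤n = ∈-map⁺ suc (∈-upTo⁺ q≤n)

∈-tuples⁺ : ∀ {A : Set} {xs ys : List A} → All (_∈ xs) ys → ys ∈ tuples (length ys) xs
∈-tuples⁺ []       = here refl
∈-tuples⁺ (p ∷ ps) = ∈-cartesianProductWith⁺ _∷_ p (∈-tuples⁺ ps)

length≤sum : ∀ {qs} → All (1 ≤_) qs → length qs ≤ sum qs
length≤sum []       = z≤n
length≤sum (p ∷ ps) = +-mono-≤ p (length≤sum ps)

parts∈ : ∀ {n qs} → All (1 ≤_) qs → sum qs ≤ n → All (_∈ [1⋯ n ]) qs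
parts∈ []                  _  = []
parts∈ {qs = q ∷ qs} (p ∷ ps) le =
  ∈-[1⋯]⁺ p (≤-trans (m≤m+n q (sum qs)) le) ∷ parts∈ ps (≤-trans (m≤n+m (sum qs) q) le)

∈-candidates⁺ : ∀ {n m qs} → Admissible n m qs → qs ∈ candidates n
∈-candidates⁺ {n} (pos , refl , _) =
  ∈-concatMap⁺ (λ k → tuples k [1⋯ n ])
    (lose (∈-upTo⁺ (s≤s (length≤sum pos))) (∈-tuples⁺ (parts∈ pos ≤-refl)))

minimum-isMinimum : ∀ xs → IsMinimum (λ c → fin c ∈ xs) (minimum xs)
minimum-isMinimum xs with minimum xs | min≤xs ⊤⁺ xs | argmin-sel (λ x → x) ⊤⁺ xs
... | fin v | le | inj₂ v∈xs = v∈xs , λ w w∈xs → [≤]-injective (All.lookup le w∈xs)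
... | ⊤⁺    | le | _         = λ w w∈xs → ⊤≰ (All.lookup le w∈xs)
  where
  ⊤≰ : ∀ {w} → ¬ (⊤⁺ ≤⁺ fin w)
  ⊤≰ ()

IsMinimum-resp : ∀ {P Q : ℕ → Set} → (∀ {c} → P c → Q c) → (∀ {c} → Q c → P c) →
                 ∀ v → IsMinimum P v → IsMinimum Q v
IsMinimum-resp f g (fin v) (pv , lb) = f pv , λ w qw → lb w (g qw)
IsMinimum-resp f g ⊤⁺      none      = λ w qw → none w (g qw)

F-isMinimum : ∀ n m → IsMinimum (λ c → ∃[ qs ] (Admissible n m qs × c ≡ cost qs)) (F n m)
F-isMinimum n m = IsMinimum-resp to from (F n m) (minimum-isMinimum _)
  where
  admissibles : List (List ℕ)
  admissibles = filter (admissible? n m) (candidates n)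

  to : ∀ {c} → fin c ∈ map (λ qs → fin (cost qs)) admissibles →
       ∃[ qs ] (Admissible n m qs × c ≡ cost qs)
  to c∈ with ∈-map⁻ (λ qs → fin (cost qs)) c∈
  ... | qs , qs∈ , refl with ∈-filter⁻ (admissible? n m) {xs = candidates n} qs∈
  ...   | _ , adm = qs , adm , refl

  from : ∀ {c} → ∃[ qs ] (Admissible n m qs × c ≡ cost qs) →
         fin c ∈ map (λ qs → fin (cost qs)) admissibles
  from (qs , adm , refl) =
    ∈-map⁺ (λ qs → fin (cost qs)) (∈-filter⁺ (admissible? n m) (∈-candidates⁺ adm) adm)

{-# OPTIONS --safe #-}
-- Removing the first part q from an admissible partition of (n , m) leaves an
-- admissible partition of (n ∸ q , m ∸ t q), and putting q in front undoes this.
-- Hence the attained values on the right are costs of admissible partitions of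
-- (n , m), and every such cost is at least one of them.
module Submission where

open import Defs
open import Data.Nat.Base using (ℕ; suc; _+_; _∸_; _≤_; z≤n; s≤s)
open import Data.Nat.ListAction using (sum)
open import Data.Nat.Properties
open import Data.List.Base using (map; []; _∷_)
open import Data.List.Membership.Propositional using (_∈_)
open import Data.List.Membership.Propositional.Properties using (∈-map⁺; ∈-map⁻; ∈-upTo⁻)
open import Data.List.Relation.Unary.All using (_∷_)
open import Data.Product.Base using (∃-syntax; _×_; _,_)
open import Relation.Binary.PropositionalEquality.Core using (_≡_; refl; sym; trans; cong; subst)
open import Relation.Nullary.Construct.Add.Supremum using (⊤⁺) renaming ([_] to fin)
open import Relation.Nullary.Negation.Core using (contradiction)

-- Mutual domination suffices: `P` and `Q` may differ as sets, provided each value of one lies above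
-- some value of the other. Equality of sets would be too strong here, since a tail of a partition
-- need not be optimal.
IsMinimum-unique : ∀ {P Q : ℕ → Set} →
  (∀ {c} → P c → ∃[ d ] (Q d × d ≤ c)) → (∀ {c} → Q c → ∃[ d ] (P d × d ≤ c)) →
  ∀ u v → IsMinimum P u → IsMinimum Q v → u ≡ v
IsMinimum-unique f g (fin u) (fin v) (pu , u≤) (qv , v≤) with f pu | g qv
... | d , qd , d≤u | e , pe , e≤v =
  cong fin (≤-antisym (≤-trans (u≤ e pe) e≤v) (≤-trans (v≤ d qd) d≤u))
IsMinimum-unique f g (fin u) ⊤⁺ (pu , _) none with f pu
... | d , qd , _ = contradiction qd (none d)
IsMinimum-unique f g ⊤⁺ (fin v) none (qv , _) with g qv
... | e , pe , _ = contradiction pe (none e)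
IsMinimum-unique f g ⊤⁺ ⊤⁺ _ _ = refl

∈-[1⋯]⁻ : ∀ {n q} → q ∈ [1⋯ n ] → 1 ≤ q × q ≤ n
∈-[1⋯]⁻ q∈ with ∈-map⁻ suc q∈
... | _ , i∈ , refl = s≤s z≤n , ∈-upTo⁻ i∈

-- `∸` plays the role of max{0, m - t(q)}: `m ≤ t q + (m ∸ t q)` holds even when `t q` exceeds `m`,
-- while `q ≤ n` makes `n ∸ q` a true difference.
Admissible-∷⁺ : ∀ {n m q qs} → 1 ≤ q → q ≤ n →
  Admissible (n ∸ q) (m ∸ t q) qs → Admissible n m (q ∷ qs)
Admissible-∷⁺ {m = m} {q} 1≤q q≤n (pos , sum≡ , m≤) =
  1≤q ∷ pos , trans (cong (q +_) sum≡) (m+[n∸m]≡n q≤n) ,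
  ≤-trans (m≤n+m∸n m (t q)) (+-monoʳ-≤ (t q) m≤)

Admissible-∷⁻ : ∀ {n m q qs} → Admissible n m (q ∷ qs) →
  q ∈ [1⋯ n ] × Admissible (n ∸ q) (m ∸ t q) qs
Admissible-∷⁻ {m = m} {q} {qs} (1≤q ∷ pos , refl , m≤) =
  ∈-[1⋯]⁺ 1≤q (m≤m+n q (sum qs)) ,
  (pos , sym (m+n∸m≡n q (sum qs)) , m≤n+o⇒m∸n≤o m (t q) m≤)

F-attained : ∀ {n m v} → F n m ≡ fin v → ∃[ qs ] (Admissible n m qs × v ≡ cost qs)
F-attained {n} {m} eq with F n m | F-isMinimum n m
F-attained refl | fin _ | attained , _ = attained

-- An admissible list excludes the value +∞, and the minimum is a lower bound for its cost.
F≤cost : ∀ {n m qs} → Admissible n m qs → ∃[ v ] (F n m ≡ fin v × v ≤ cost qs)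
F≤cost {n} {m} {qs} adm with F n m | F-isMinimum n m
... | fin v | _ , v≤ = v , refl , v≤ (cost qs) (qs , adm , refl)
... | ⊤⁺    | none   = contradiction (qs , adm , refl) (none (cost qs))

+∞-fin⁻ : ∀ {a c} x → fin c ≡ a +∞ x → ∃[ v ] (x ≡ fin v × c ≡ a + v)
+∞-fin⁻ (fin v) refl = v , refl , refl

theorem1p5 : ∀ (n m : ℕ) → 1 ≤ n → m ≤ t n →
    F n m ≡ minimum (map (λ q → s q +∞ F (n ∸ q) (m ∸ t q)) [1⋯ n ])
theorem1p5 n m 1≤n _ =
  IsMinimum-unique split join (F n m) (minimum (map G [1⋯ n ]))
    (F-isMinimum n m) (minimum-isMinimum (map G [1⋯ n ]))
  where
  G : ℕ → ℕ∞
  G q = s q +∞ F (n ∸ q) (m ∸ t q)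

  split : ∀ {c} → ∃[ qs ] (Admissible n m qs × c ≡ cost qs) →
          ∃[ d ] (fin d ∈ map G [1⋯ n ] × d ≤ c)
  -- The empty partition sums to 0, so `1 ≤ n` guarantees a first part to remove.
  split ([] , (_ , 0≡n , _) , _) = contradiction 0≡n (<⇒≢ 1≤n)
  split (q ∷ qs , adm , refl) with Admissible-∷⁻ adm
  ... | q∈ , adm′ with F≤cost adm′
  ...   | v , F≡v , v≤ =
    -- Replacing the tail by an optimal one keeps the contribution `s q` and can only lower the
    -- cost.
    s q + v , subst (_∈ map G [1⋯ n ]) (cong (s q +∞_) F≡v) (∈-map⁺ G q∈) , +-monoʳ-≤ (s q) v≤

  join : ∀ {c} → fin c ∈ map G [1⋯ n ] →
         ∃[ d ] ((∃[ qs ] (Admissible n m qs × d ≡ cost qs)) × d ≤ c)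
  join {c} c∈ with ∈-map⁻ G c∈
  ... | q , q∈ , c≡ with +∞-fin⁻ (F (n ∸ q) (m ∸ t q)) c≡ | ∈-[1⋯]⁻ q∈
  ...   | v , F≡v , c≡s+v | 1≤q , q≤n with F-attained F≡v
  ...     | qs , adm , v≡ =
    -- The tail `qs` attains `F (n ∸ q) (m ∸ t q)`, so prefixing `q` gives cost exactly `c`.
    c , (q ∷ qs , Admissible-∷⁺ 1≤q q≤n adm , trans c≡s+v (cong (s q +_) v≡)) , ≤-refl
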